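{- Let $(G_m)_{m\in\mathbb{Z}}$ be a generalized Fibonacci sequence, let $a,b$ be integers, let $n\ge 0$ be an integer, and let $x$ be a complex number such that $\Delta := 1-L_b x+(-1)^b x^2\neq 0$. Then $$\sum_{k=0}^n x^k G_{a+bk} = -\frac{1}{\Delta}\left[ x^{n+1} P(1,n+1) - P(1,0) \right].$$
   Context: A generalized Fibonacci sequence is a sequence $(G_m)_{m\in\mathbb{Z}}$ of complex numbers with $G_{m+2}=G_{m+1}+G_m$ for all integers $m$ (with arbitrary seed $G_0,G_1$). $L_m$ is the Lucas number: $L_0=2$, $L_1=1$, $L_{m+2}=L_{m+1}+L_m$ for all integers $m$ (including negative indices). For given $a,b,x$ and $G$, and for integers $v,w\ge 0$, $P(v,w) = \sum_{k=0}^v \binom{v}{k} (-1)^{(b+1)k} x^k G_{a+bw-bk}$. Convention: $x^0=1$, also for $x=0$. -}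

module Defs where

open import Algebra.Apartness.Bundles using (HeytingField)
open import Algebra.Apartness.Structures using (IsHeytingCommutativeRing; IsHeytingField)
open import Algebra.Bundles using (CommutativeRing)
open import Algebra.Structures using (IsCommutativeRing)
open import Data.Fin.Base using (toℕ)
open import Data.Integer.Base as ℤ using (ℤ; +_; -[1+_])
import Data.Integer.Solver as ℤSolver
open import Data.Nat.Base as ℕ using (ℕ; zero; suc)
open import Data.Nat.Combinatorics using (_C_)
import Data.Nat.Properties as ℕ
open import Data.Product.Base using (Σ-syntax; ∃-syntax; _×_; _,_; proj₁; proj₂)
open import Data.Rational.Base as ℚ using (ℚ; 0ℚ; 1ℚ; ½; ∣_∣)
import Data.Rational.Properties as ℚ
open import Data.Rational.Solver using (module +-*-Solver)
open import Data.Sum.Base using (_⊎_; inj₁; inj₂; [_,_]; map)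
open import Function.Base using (_∘_; id)
open import Level using (0ℓ)
open import Relation.Binary.PropositionalEquality.Core
  using (_≡_; _≢_; refl; sym; trans; cong; cong₂; subst)
open import Relation.Binary.PropositionalEquality.Properties using (module ≡-Reasoning)
open import Relation.Binary.Structures using (IsEquivalence; IsApartnessRelation)
open import Relation.Nullary.Decidable.Core using (Dec; yes; no)
open import Relation.Nullary.Negation.Core using (¬_; contradiction)

------------------------------------------------------------------------
-- Rational estimates

private
  module Estimates where
    open import Data.Rational.Base
      using (_+_; _-_; _*_; -_; 1/_; _<_; _≤_; positive; nonNegative; ≢-nonZero)
    open ℚ.≤-Reasoning
    open +-*-Solver using (solve; _:*_; :-_; _:=_)

    ½-pos : ∀ {ε} → 0ℚ < ε → 0ℚ < ½ * ε
    ½-pos {ε} 0<ε = subst (_< ½ * ε) (ℚ.*-zeroʳ ½) (ℚ.*-monoʳ-<-pos ½ 0<ε)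

    halves : ∀ ε → ½ * ε + ½ * ε ≡ ε
    halves ε = trans (sym (ℚ.*-distribʳ-+ ε ½ ½)) (ℚ.*-identityˡ ε)

    *-pos : ∀ {p q} → 0ℚ < p → 0ℚ < q → 0ℚ < p * q
    *-pos {p} {q} 0<p 0<q =
      subst (_< p * q) (ℚ.*-zeroʳ p) (ℚ.*-monoʳ-<-pos p {{positive 0<p}} 0<q)

    small+ : ∀ {ε} p q → ∣ p ∣ < ½ * ε → ∣ q ∣ < ½ * ε → ∣ p + q ∣ < ε
    small+ {ε} p q p< q< = begin-strict
      ∣ p + q ∣        ≤⟨ ℚ.∣p+q∣≤∣p∣+∣q∣ p q ⟩
      ∣ p ∣ + ∣ q ∣    <⟨ ℚ.+-mono-< p< q< ⟩
      ½ * ε + ½ * ε    ≡⟨ halves ε ⟩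
      ε                ∎

    small- : ∀ {ε} p → ∣ p ∣ < ε → ∣ - p ∣ < ε
    small- {ε} p = subst (_< ε) (sym (ℚ.∣-p∣≡∣p∣ p))

    -- The junk value 0 at 0 makes this a total function.
    inv : ℚ → ℚ
    inv p with p ℚ.≟ 0ℚ
    ... | yes _  = 0ℚ
    ... | no p≢0 = (1/ p) {{≢-nonZero p≢0}}

    inv-inverseʳ : ∀ p → p ≢ 0ℚ → p * inv p ≡ 1ℚ
    inv-inverseʳ p p≢0 with p ℚ.≟ 0ℚ
    ... | yes p≡0 = contradiction p≡0 p≢0
    ... | no p≢0′ = ℚ.*-inverseʳ p {{≢-nonZero p≢0′}}

    pos⇒≢0 : ∀ {p} → 0ℚ < p → p ≢ 0ℚ
    pos⇒≢0 0<p refl = ℚ.<-irrefl refl 0<p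

    inv-pos : ∀ {p} → 0ℚ < p → 0ℚ < inv p
    inv-pos {p} 0<p with p ℚ.≟ 0ℚ
    ... | yes p≡0 = contradiction p≡0 (pos⇒≢0 0<p)
    ... | no p≢0  = ℚ.positive⁻¹ _ {{ℚ.1/pos⇒pos p {{positive 0<p}}}}

    small* : ∀ {ε B} p q → 0ℚ < B → ∣ p ∣ ≤ B → ∣ q ∣ < inv B * ε → ∣ p * q ∣ < ε
    small* {ε} {B} p q 0<B p≤ q< = begin-strict
      ∣ p * q ∣          ≡⟨ ℚ.∣p*q∣≡∣p∣*∣q∣ p q ⟩
      ∣ p ∣ * ∣ q ∣      ≤⟨ ℚ.*-monoʳ-≤-nonNeg ∣ q ∣ {{ℚ.∣-∣-nonNeg q}} p≤ ⟩
      B * ∣ q ∣          <⟨ ℚ.*-monoʳ-<-pos B {{positive 0<B}} q< ⟩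
      B * (inv B * ε)    ≡⟨ ℚ.*-assoc B (inv B) ε ⟨
      B * inv B * ε      ≡⟨ cong (_* ε) (inv-inverseʳ B (pos⇒≢0 0<B)) ⟩
      1ℚ * ε             ≡⟨ ℚ.*-identityˡ ε ⟩
      ε                  ∎

    away⇒≢0 : ∀ {δ} p → 0ℚ < δ → δ ≤ ∣ p ∣ → p ≢ 0ℚ
    away⇒≢0 p 0<δ δ≤ refl = ℚ.<-irrefl refl (ℚ.<-≤-trans 0<δ δ≤)

    inv-bound : ∀ {δ} p → 0ℚ < δ → δ ≤ ∣ p ∣ → ∣ inv p ∣ ≤ inv δ
    inv-bound {δ} p 0<δ δ≤ = begin
      ∣ inv p ∣                    ≡⟨ ℚ.*-identityʳ _ ⟨
      ∣ inv p ∣ * 1ℚ               ≡⟨ cong (∣ inv p ∣ *_) (inv-inverseʳ δ (pos⇒≢0 0<δ)) ⟨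
      ∣ inv p ∣ * (δ * inv δ)      ≤⟨ ℚ.*-monoˡ-≤-nonNeg ∣ inv p ∣ {{ℚ.∣-∣-nonNeg (inv p)}}
                                        (ℚ.*-monoʳ-≤-nonNeg (inv δ) {{nonNegative (ℚ.<⇒≤ (inv-pos 0<δ))}} δ≤) ⟩
      ∣ inv p ∣ * (∣ p ∣ * inv δ)  ≡⟨ solve 3 (λ a b c → a :* (b :* c) := (b :* a) :* c)
                                        refl ∣ inv p ∣ ∣ p ∣ (inv δ) ⟩
      ∣ p ∣ * ∣ inv p ∣ * inv δ    ≡⟨ cong (_* inv δ) (ℚ.∣p*q∣≡∣p∣*∣q∣ p (inv p)) ⟨
      ∣ p * inv p ∣ * inv δ        ≡⟨ cong (λ t → ∣ t ∣ * inv δ)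
                                        (inv-inverseʳ p (away⇒≢0 p 0<δ δ≤)) ⟩
      1ℚ * inv δ                   ≡⟨ ℚ.*-identityˡ _ ⟩
      inv δ                        ∎

    sq-abs : ∀ p → p * p ≡ ∣ p ∣ * ∣ p ∣
    sq-abs p with ℚ.∣p∣≡p∨∣p∣≡-p p
    ... | inj₁ eq = sym (cong₂ _*_ eq eq)
    ... | inj₂ eq = trans (solve 1 (λ p → p :* p := (:- p) :* (:- p)) refl p)
                          (sym (cong₂ _*_ eq eq))

    sq≥0 : ∀ p → 0ℚ ≤ p * p
    sq≥0 p = begin
      0ℚ               ≡⟨ ℚ.*-zeroʳ ∣ p ∣ ⟨
      ∣ p ∣ * 0ℚ       ≤⟨ ℚ.*-monoˡ-≤-nonNeg ∣ p ∣ {{ℚ.∣-∣-nonNeg p}} (ℚ.0≤∣p∣ p) ⟩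
      ∣ p ∣ * ∣ p ∣    ≡⟨ sq-abs p ⟨
      p * p            ∎

    sq-away : ∀ {δ} p q → 0ℚ < δ → δ ≤ ∣ p ∣ → δ * δ ≤ ∣ p * p + q * q ∣
    sq-away {δ} p q 0<δ δ≤ = begin
      δ * δ              ≤⟨ ℚ.*-monoˡ-≤-nonNeg δ {{nonNegative (ℚ.<⇒≤ 0<δ)}} δ≤ ⟩
      δ * ∣ p ∣          ≤⟨ ℚ.*-monoʳ-≤-nonNeg ∣ p ∣ {{ℚ.∣-∣-nonNeg p}} δ≤ ⟩
      ∣ p ∣ * ∣ p ∣      ≡⟨ sq-abs p ⟨
      p * p              ≡⟨ ℚ.+-identityʳ (p * p) ⟨
      p * p + 0ℚ         ≤⟨ ℚ.+-monoʳ-≤ (p * p) (sq≥0 q) ⟩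
      p * p + q * q      ≡⟨ ℚ.0≤p⇒∣p∣≡p (ℚ.+-mono-≤ (sq≥0 p) (sq≥0 q)) ⟨
      ∣ p * p + q * q ∣  ∎

    ½< : ∀ {ε} → 0ℚ < ε → ½ * ε < ε
    ½< {ε} 0<ε = begin-strict
      ½ * ε            ≡⟨ ℚ.+-identityʳ (½ * ε) ⟨
      ½ * ε + 0ℚ       <⟨ ℚ.+-monoʳ-< (½ * ε) (½-pos 0<ε) ⟩
      ½ * ε + ½ * ε    ≡⟨ halves ε ⟩
      ε                ∎

open Estimates

------------------------------------------------------------------------
-- Sequences of rationals

Eventually : (ℕ → Set) → Set
Eventually P = ∃[ N ] ∀ n → N ℕ.≤ n → P n

IsCauchy : (ℕ → ℚ) → Set
IsCauchy x = ∀ ε → 0ℚ ℚ.< ε →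
  ∃[ N ] ∀ m n → N ℕ.≤ m → N ℕ.≤ n → ∣ x m ℚ.- x n ∣ ℚ.< ε

Vanishing : (ℕ → ℚ) → Set
Vanishing d = ∀ ε → 0ℚ ℚ.< ε → Eventually λ n → ∣ d n ∣ ℚ.< ε

BoundedAway : (ℕ → ℚ) → Set
BoundedAway d = ∃[ δ ] 0ℚ ℚ.< δ × Eventually λ n → δ ℚ.≤ ∣ d n ∣

private
  module Sequences where
    open import Data.Rational.Base
      using (_+_; _-_; _*_; -_; 1/_; _<_; _≤_; positive; nonNegative; ≢-nonZero)
    open +-*-Solver using (solve; _:+_; _:*_; :-_; _:-_; _:=_; con)

    Seq : Set
    Seq = ℕ → ℚ

    both : ∀ {P Q : ℕ → Set} → Eventually P → Eventually Q → Eventually λ n → P n × Q n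
    both (M , p) (N , q) = M ℕ.⊔ N , λ n M⊔N≤n →
      p n (ℕ.m⊔n≤o⇒m≤o M N M⊔N≤n) , q n (ℕ.m⊔n≤o⇒n≤o M N M⊔N≤n)

    mapEv : ∀ {P Q : ℕ → Set} → (∀ n → P n → Q n) → Eventually P → Eventually Q
    mapEv f (N , p) = N , λ n N≤n → f n (p n N≤n)

    never : ∀ {P : ℕ → Set} → (∀ n → ¬ P n) → ¬ Eventually P
    never ¬p (N , p) = ¬p N (p N ℕ.≤-refl)

    resp : ∀ {ε p q} → p ≡ q → ∣ q ∣ < ε → ∣ p ∣ < ε
    resp {ε} p≡q = subst (λ t → ∣ t ∣ < ε) (sym p≡q)

    abstract
      const-cauchy : ∀ q → IsCauchy λ _ → q
      const-cauchy q ε 0<ε = 0 , λ _ _ _ _ → subst (λ t → ∣ t ∣ < ε) (sym (ℚ.+-inverseʳ q)) 0<ε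

      +-cauchy : ∀ {x y} → IsCauchy x → IsCauchy y → IsCauchy λ n → x n + y n
      +-cauchy {x} {y} cx cy ε 0<ε =
        let M , p = cx (½ * ε) (½-pos 0<ε)
            N , q = cy (½ * ε) (½-pos 0<ε)
        in M ℕ.⊔ N , λ m n ≤m ≤n →
        resp (solve 4 (λ a b c d → (a :+ b) :- (c :+ d) := (a :- c) :+ (b :- d)) refl
                (x m) (y m) (x n) (y n))
          (small+ (x m - x n) (y m - y n)
            (p m n (ℕ.m⊔n≤o⇒m≤o M N ≤m) (ℕ.m⊔n≤o⇒m≤o M N ≤n))
            (q m n (ℕ.m⊔n≤o⇒n≤o M N ≤m) (ℕ.m⊔n≤o⇒n≤o M N ≤n)))

      neg-cauchy : ∀ {x} → IsCauchy x → IsCauchy λ n → - x n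
      neg-cauchy {x} cx ε 0<ε = let N , p = cx ε 0<ε in N , λ m n ≤m ≤n →
        resp (solve 2 (λ a b → (:- a) :- (:- b) := :- (a :- b)) refl (x m) (x n))
          (small- (x m - x n) (p m n ≤m ≤n))

      bounded : ∀ {x} → IsCauchy x → ∃[ B ] 0ℚ < B × Eventually λ n → ∣ x n ∣ ≤ B
      bounded {x} cx = let N , p = cx 1ℚ (ℚ.positive⁻¹ 1ℚ) in
        ∣ x N ∣ + 1ℚ , ℚ.+-mono-≤-< (ℚ.0≤∣p∣ (x N)) (ℚ.positive⁻¹ 1ℚ) , N , λ n N≤n →
        begin
          ∣ x n ∣                    ≡⟨ cong ∣_∣ (solve 2 (λ a b → a := b :+ (a :- b)) refl (x n) (x N)) ⟩
          ∣ x N + (x n - x N) ∣      ≤⟨ ℚ.∣p+q∣≤∣p∣+∣q∣ (x N) (x n - x N) ⟩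
          ∣ x N ∣ + ∣ x n - x N ∣    ≤⟨ ℚ.+-monoʳ-≤ ∣ x N ∣ (ℚ.<⇒≤ (p n N N≤n ℕ.≤-refl)) ⟩
          ∣ x N ∣ + 1ℚ               ∎
        where open ℚ.≤-Reasoning

      *-cauchy : ∀ {x y} → IsCauchy x → IsCauchy y → IsCauchy λ n → x n * y n
      *-cauchy {x} {y} cx cy ε 0<ε =
        let B , 0<B , K , b = bounded cx
            C , 0<C , L , c = bounded cy
            M , p = cx (inv C * (½ * ε)) (*-pos (inv-pos 0<C) (½-pos 0<ε))
            N , q = cy (inv B * (½ * ε)) (*-pos (inv-pos 0<B) (½-pos 0<ε))
        in (K ℕ.⊔ L) ℕ.⊔ (M ℕ.⊔ N) , λ m n ≤m ≤n →
        let KL≤m = ℕ.m⊔n≤o⇒m≤o (K ℕ.⊔ L) (M ℕ.⊔ N) ≤m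
            KL≤n = ℕ.m⊔n≤o⇒m≤o (K ℕ.⊔ L) (M ℕ.⊔ N) ≤n
            MN≤m = ℕ.m⊔n≤o⇒n≤o (K ℕ.⊔ L) (M ℕ.⊔ N) ≤m
            MN≤n = ℕ.m⊔n≤o⇒n≤o (K ℕ.⊔ L) (M ℕ.⊔ N) ≤n
        in
        resp (solve 4 (λ a b c d → (a :* b) :- (c :* d) := a :* (b :- d) :+ d :* (a :- c)) refl
                (x m) (y m) (x n) (y n))
          (small+ (x m * (y m - y n)) (y n * (x m - x n))
            (small* (x m) (y m - y n) 0<B (b m (ℕ.m⊔n≤o⇒m≤o K L KL≤m))
              (q m n (ℕ.m⊔n≤o⇒n≤o M N MN≤m) (ℕ.m⊔n≤o⇒n≤o M N MN≤n)))
            (small* (y n) (x m - x n) 0<C (c n (ℕ.m⊔n≤o⇒n≤o K L KL≤n))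
              (p m n (ℕ.m⊔n≤o⇒m≤o M N MN≤m) (ℕ.m⊔n≤o⇒m≤o M N MN≤n))))

      inv-cauchy : ∀ {x} → IsCauchy x → BoundedAway x → IsCauchy λ n → inv (x n)
      inv-cauchy {x} cx (δ , 0<δ , M , far) ε 0<ε =
        let B   = inv δ * inv δ
            0<B = *-pos (inv-pos 0<δ) (inv-pos 0<δ)
            N , p = cx (inv B * ε) (*-pos (inv-pos 0<B) 0<ε)
        in M ℕ.⊔ N , λ m n ≤m ≤n →
        let M≤m = ℕ.m⊔n≤o⇒m≤o M N ≤m
            M≤n = ℕ.m⊔n≤o⇒m≤o M N ≤n
        in
        resp (inv-difference (x m) (x n) (away⇒≢0 (x m) 0<δ (far m M≤m)) (away⇒≢0 (x n) 0<δ (far n M≤n)))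
          (small* (inv (x m) * inv (x n)) (x n - x m) 0<B
            (product-bound (x m) (x n) (far m M≤m) (far n M≤n))
            (p n m (ℕ.m⊔n≤o⇒n≤o M N ≤n) (ℕ.m⊔n≤o⇒n≤o M N ≤m)))
        where
        inv-difference : ∀ p q → p ≢ 0ℚ → q ≢ 0ℚ → inv p - inv q ≡ inv p * inv q * (q - p)
        inv-difference p q p≢0 q≢0 = begin
          inv p - inv q                            ≡⟨ cong₂ _-_ (ℚ.*-identityʳ (inv p)) (ℚ.*-identityʳ (inv q)) ⟨
          inv p * 1ℚ - inv q * 1ℚ                  ≡⟨ cong₂ (λ s t → inv p * s - inv q * t)
                                                        (inv-inverseʳ q q≢0) (inv-inverseʳ p p≢0) ⟨
          inv p * (q * inv q) - inv q * (p * inv p)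
            ≡⟨ solve 4 (λ p q i j → i :* (q :* j) :- j :* (p :* i) := i :* j :* (q :- p)) refl
                 p q (inv p) (inv q) ⟩
          inv p * inv q * (q - p)                  ∎
          where open ≡-Reasoning
        product-bound : ∀ p q → δ ≤ ∣ p ∣ → δ ≤ ∣ q ∣ → ∣ inv p * inv q ∣ ≤ inv δ * inv δ
        product-bound p q δ≤p δ≤q = begin
          ∣ inv p * inv q ∣      ≡⟨ ℚ.∣p*q∣≡∣p∣*∣q∣ (inv p) (inv q) ⟩
          ∣ inv p ∣ * ∣ inv q ∣  ≤⟨ ℚ.*-monoʳ-≤-nonNeg ∣ inv q ∣ {{ℚ.∣-∣-nonNeg (inv q)}}
                                      (inv-bound p 0<δ δ≤p) ⟩
          inv δ * ∣ inv q ∣      ≤⟨ ℚ.*-monoˡ-≤-nonNeg (inv δ) {{nonNegative (ℚ.<⇒≤ (inv-pos 0<δ))}}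
                                      (inv-bound q 0<δ δ≤q) ⟩
          inv δ * inv δ          ∎
          where open ℚ.≤-Reasoning

      vanish-≡ : ∀ {d} → Eventually (λ n → d n ≡ 0ℚ) → Vanishing d
      vanish-≡ ev ε 0<ε = mapEv (λ n d≡0 → resp d≡0 0<ε) ev

      vanish-neg : ∀ {d e} → (∀ n → e n ≡ - d n) → Vanishing d → Vanishing e
      vanish-neg {d} eq v ε 0<ε = mapEv (λ n lt → resp (eq n) (small- (d n) lt)) (v ε 0<ε)

      vanish-+ : ∀ {d e f} → (∀ n → f n ≡ d n + e n) → Vanishing d → Vanishing e → Vanishing f
      vanish-+ {d} {e} eq v w ε 0<ε =
        mapEv (λ n (p , q) → resp (eq n) (small+ (d n) (e n) p q))
          (both (v (½ * ε) (½-pos 0<ε)) (w (½ * ε) (½-pos 0<ε)))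

      vanish-* : ∀ {x d} → IsCauchy x → Vanishing d → Vanishing λ n → x n * d n
      vanish-* {x} {d} cx v ε 0<ε = let B , 0<B , b = bounded cx in
                          mapEv (λ n (p , q) → small* (x n) (d n) 0<B p q)
                            (both b (v (inv B * ε) (*-pos (inv-pos 0<B) 0<ε)))

      vanish⇒¬away : ∀ {d} → Vanishing d → ¬ BoundedAway d
      vanish⇒¬away v (δ , 0<δ , far) =
        never (λ n (p , q) → ℚ.<-irrefl refl (ℚ.<-≤-trans p q)) (both (v δ 0<δ) far)

      dichotomy : ∀ {d} → IsCauchy d → ∀ ε → 0ℚ < ε →
                  Eventually (λ n → ∣ d n ∣ < ε) ⊎ BoundedAway d
      dichotomy {d} cd ε 0<ε =
        let N , p = cd (½ * (½ * ε)) (½-pos (½-pos 0<ε)) in decide N p (∣ d N ∣ ℚ.<? ½ * ε)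
        where
        decide : ∀ N → (∀ m n → N ℕ.≤ m → N ℕ.≤ n → ∣ d m - d n ∣ < ½ * (½ * ε)) →
                 Dec (∣ d N ∣ < ½ * ε) →
                 Eventually (λ n → ∣ d n ∣ < ε) ⊎ BoundedAway d
        decide N p (yes small) = inj₁ (N , λ n N≤n →
          resp (solve 2 (λ a b → a := b :+ (a :- b)) refl (d n) (d N))
            (small+ (d N) (d n - d N) small
              (ℚ.<-trans (p n N N≤n ℕ.≤-refl) (½< (½-pos 0<ε)))))
        decide N p (no large) = inj₂ (½ * (½ * ε) , ½-pos (½-pos 0<ε) , N , λ n N≤n →
          ℚ.≮⇒≥ λ lt → large
            (resp (solve 2 (λ a b → a := b :+ (a :- b)) refl (d N) (d n))
              (small+ (d n) (d N - d n) lt (p N n ℕ.≤-refl N≤n))))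

      ¬away⇒vanish : ∀ {d} → IsCauchy d → ¬ BoundedAway d → Vanishing d
      ¬away⇒vanish cd ¬away ε 0<ε = [ id , (λ away → contradiction away ¬away) ] (dichotomy cd ε 0<ε)

      away-neg : ∀ {d e} → (∀ n → e n ≡ - d n) → BoundedAway d → BoundedAway e
      away-neg {d} eq (δ , 0<δ , far) = δ , 0<δ ,
        mapEv (λ n → subst (δ ≤_) (sym (trans (cong ∣_∣ (eq n)) (ℚ.∣-p∣≡∣p∣ (d n))))) far

      away-+ : ∀ {d e f} → IsCauchy d → IsCauchy e → (∀ n → f n ≡ d n + e n) →
               BoundedAway f → BoundedAway d ⊎ BoundedAway e
      away-+ {d} {e} cd ce eq (δ , 0<δ , far) =
        cases (dichotomy cd (½ * δ) (½-pos 0<δ)) (dichotomy ce (½ * δ) (½-pos 0<δ))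
        where
        cases : Eventually (λ n → ∣ d n ∣ < ½ * δ) ⊎ BoundedAway d →
                Eventually (λ n → ∣ e n ∣ < ½ * δ) ⊎ BoundedAway e →
                BoundedAway d ⊎ BoundedAway e
        cases (inj₂ away) _           = inj₁ away
        cases (inj₁ _)    (inj₂ away) = inj₂ away
        cases (inj₁ p)    (inj₁ q)    = contradiction (both far (both p q)) (never λ n (r , p , q) →
          ℚ.<-irrefl refl (ℚ.≤-<-trans r (resp (eq n) (small+ (d n) (e n) p q))))

      away-* : ∀ {d x} → IsCauchy d → IsCauchy x → BoundedAway (λ n → d n * x n) → BoundedAway d
      away-* {d} {x} cd cx (δ , 0<δ , far) =
        let B , 0<B , b = bounded cx
            near p = contradiction (both far (both b p)) (never λ n (r , s , t) →
              ℚ.<-irrefl refl (ℚ.≤-<-trans r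
                (resp (ℚ.*-comm (d n) (x n)) (small* (x n) (d n) 0<B s t))))
        in [ near , id ] (dichotomy cd (inv B * δ) (*-pos (inv-pos 0<B) 0<δ))

      away-1 : ∀ {d} → Vanishing (λ n → d n - 1ℚ) → BoundedAway d
      away-1 {d} v = ½ * 1ℚ , ½-pos (ℚ.positive⁻¹ 1ℚ) ,
        mapEv (λ n lt → ℚ.≮⇒≥ λ lt′ → ℚ.<-irrefl refl
            (resp {p = 1ℚ} (solve 1 (λ a → con 1ℚ := a :+ (:- (a :- con 1ℚ))) refl (d n))
              (small+ (d n) (- (d n - 1ℚ)) lt′ (small- (d n - 1ℚ) lt))))
          (v (½ * 1ℚ) (½-pos (ℚ.positive⁻¹ 1ℚ)))

      away-sq : ∀ {x y} → BoundedAway x ⊎ BoundedAway y → BoundedAway λ n → x n * x n + y n * y n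
      away-sq {x} {y} (inj₁ (δ , 0<δ , far)) =
        δ * δ , *-pos 0<δ 0<δ , mapEv (λ n le → sq-away (x n) (y n) 0<δ le) far
      away-sq {x} {y} (inj₂ (δ , 0<δ , far)) =
        δ * δ , *-pos 0<δ 0<δ , mapEv (λ n le →
          subst (λ t → δ * δ ≤ ∣ t ∣) (ℚ.+-comm (y n * y n) (x n * x n))
            (sq-away (y n) (x n) 0<δ le)) far

open Sequences

------------------------------------------------------------------------
-- Real numbers, as Cauchy sequences of rationals

infix 4 _≃_ _#ᴿ_
infixl 6 _+ᴿ_
infixl 7 _*ᴿ_
infix 8 -ᴿ_

record ℝ : Set where
  no-eta-equality
  constructor mkℝ
  field
    seq    : ℕ → ℚ
    cauchy : IsCauchy seq

open ℝ public

difference : ℝ → ℝ → ℕ → ℚ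
difference x y n = seq x n ℚ.- seq y n

record _≃_ (x y : ℝ) : Set where
  constructor mk≃
  field
    vanishing : Vanishing (difference x y)

open _≃_ public

record _#ᴿ_ (x y : ℝ) : Set where
  constructor mk#
  field
    boundedAway : BoundedAway (difference x y)

open _#ᴿ_ public

fromℚ : ℚ → ℝ
seq    (fromℚ q) _ = q
cauchy (fromℚ q)   = const-cauchy q

_+ᴿ_ : ℝ → ℝ → ℝ
seq    (x +ᴿ y) n = seq x n ℚ.+ seq y n
cauchy (x +ᴿ y)   = +-cauchy {seq x} {seq y} (cauchy x) (cauchy y)

_*ᴿ_ : ℝ → ℝ → ℝ
seq    (x *ᴿ y) n = seq x n ℚ.* seq y n
cauchy (x *ᴿ y)   = *-cauchy {seq x} {seq y} (cauchy x) (cauchy y)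

-ᴿ_ : ℝ → ℝ
seq    (-ᴿ x) n = ℚ.- seq x n
cauchy (-ᴿ x)   = neg-cauchy {seq x} (cauchy x)

private
  module Reals where
    open import Data.Rational.Base
      using (_+_; _-_; _*_; -_; 1/_; _<_; _≤_; positive; nonNegative; ≢-nonZero)
    open +-*-Solver using (solve; _:+_; _:*_; :-_; _:-_; _:=_; con)

    eventually-≡⇒≃ : ∀ {x y} → Eventually (λ n → seq x n ≡ seq y n) → x ≃ y
    eventually-≡⇒≃ {x} {y} ev = mk≃ (vanish-≡ {difference x y}
      (mapEv (λ n eq → trans (cong (_- seq y n) eq) (ℚ.+-inverseʳ (seq y n))) ev))

    ≡⇒≃ : ∀ {x y} → (∀ n → seq x n ≡ seq y n) → x ≃ y
    ≡⇒≃ {x} {y} eq = eventually-≡⇒≃ {x} {y} (0 , λ n _ → eq n)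

    ≃-refl : ∀ {x} → x ≃ x
    ≃-refl {x} = ≡⇒≃ {x} {x} λ _ → refl

    ≃-sym : ∀ {x y} → x ≃ y → y ≃ x
    ≃-sym {x} {y} (mk≃ v) = mk≃ (vanish-neg {difference x y} {difference y x}
      (λ n → solve 2 (λ a b → b :- a := :- (a :- b)) refl (seq x n) (seq y n)) v)

    ≃-trans : ∀ {x y z} → x ≃ y → y ≃ z → x ≃ z
    ≃-trans {x} {y} {z} (mk≃ v) (mk≃ w) =
      mk≃ (vanish-+ {difference x y} {difference y z} {difference x z}
        (λ n → solve 3 (λ a b c → a :- c := (a :- b) :+ (b :- c)) refl
                 (seq x n) (seq y n) (seq z n)) v w)

    +ᴿ-cong : ∀ {x x′ y y′} → x ≃ x′ → y ≃ y′ → x +ᴿ y ≃ x′ +ᴿ y′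
    +ᴿ-cong {x} {x′} {y} {y′} (mk≃ v) (mk≃ w) =
      mk≃ (vanish-+ {difference x x′} {difference y y′} {difference (x +ᴿ y) (x′ +ᴿ y′)}
        (λ n → solve 4 (λ a a′ b b′ → (a :+ b) :- (a′ :+ b′) := (a :- a′) :+ (b :- b′)) refl
                 (seq x n) (seq x′ n) (seq y n) (seq y′ n)) v w)

    -ᴿ-cong : ∀ {x y} → x ≃ y → -ᴿ x ≃ -ᴿ y
    -ᴿ-cong {x} {y} (mk≃ v) = mk≃ (vanish-neg {difference x y} {difference (-ᴿ x) (-ᴿ y)}
      (λ n → solve 2 (λ a b → (:- a) :- (:- b) := :- (a :- b)) refl (seq x n) (seq y n)) v)

    *ᴿ-cong : ∀ {x x′ y y′} → x ≃ x′ → y ≃ y′ → x *ᴿ y ≃ x′ *ᴿ y′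
    *ᴿ-cong {x} {x′} {y} {y′} (mk≃ v) (mk≃ w) =
      mk≃ (vanish-+ {λ n → seq y′ n * difference x x′ n} {λ n → seq x n * difference y y′ n}
                    {difference (x *ᴿ y) (x′ *ᴿ y′)}
        (λ n → solve 4 (λ a a′ b b′ → (a :* b) :- (a′ :* b′) := b′ :* (a :- a′) :+ a :* (b :- b′))
                 refl (seq x n) (seq x′ n) (seq y n) (seq y′ n))
        (vanish-* {seq y′} {difference x x′} (cauchy y′) v)
        (vanish-* {seq x} {difference y y′} (cauchy x) w))

open Reals

------------------------------------------------------------------------
-- Complex numbers

infix 4 _≈_ _#_
infixl 6 _+_ _-_
infixl 7 _*_
infix 8 -_

record ℂ : Set where
  no-eta-equality
  constructor _+i_
  field
    re : ℝ
    im : ℝ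

open ℂ public

record _≈_ (z w : ℂ) : Set where
  constructor mk≈
  field
    re≃ : re z ≃ re w
    im≃ : im z ≃ im w

open _≈_ public

-- The constructive form of z ≠ w: by tightness below, ¬ (z # w) is equivalent
-- to z ≈ w, so that classically z # w and ¬ (z ≈ w) coincide.
data _#_ (z w : ℂ) : Set where
  re# : re z #ᴿ re w → z # w
  im# : im z #ᴿ im w → z # w

_+_ : ℂ → ℂ → ℂ
re (z + w) = re z +ᴿ re w
im (z + w) = im z +ᴿ im w

_*_ : ℂ → ℂ → ℂ
re (z * w) = (re z *ᴿ re w) +ᴿ (-ᴿ (im z *ᴿ im w))
im (z * w) = (re z *ᴿ im w) +ᴿ (im z *ᴿ re w)

-_ : ℂ → ℂ
re (- z) = -ᴿ re z
im (- z) = -ᴿ im z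

_-_ : ℂ → ℂ → ℂ
z - w = z + (- w)

fromℤ : ℤ → ℂ
re (fromℤ i) = fromℚ (i ℚ./ 1)
im (fromℤ i) = fromℚ 0ℚ

0ℂ 1ℂ : ℂ
0ℂ = fromℚ 0ℚ +i fromℚ 0ℚ
1ℂ = fromℚ 1ℚ +i fromℚ 0ℚ

private
  module Complex where
    open +-*-Solver using (solve; _:+_; _:*_; :-_; _:-_; _:=_; con)

    pointwise : ∀ {z w} → (∀ n → seq (re z) n ≡ seq (re w) n) →
                (∀ n → seq (im z) n ≡ seq (im w) n) → z ≈ w
    pointwise {z} {w} p q = mk≈ (≡⇒≃ {re z} {re w} p) (≡⇒≃ {im z} {im w} q)

    ≈-isEquivalence : IsEquivalence _≈_
    ≈-isEquivalence = record
      { refl  = mk≈ ≃-refl ≃-refl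
      ; sym   = λ (mk≈ p q) → mk≈ (≃-sym p) (≃-sym q)
      ; trans = λ (mk≈ p q) (mk≈ r s) → mk≈ (≃-trans p r) (≃-trans q s)
      }

    +-cong : ∀ {x x′ y y′} → x ≈ x′ → y ≈ y′ → x + y ≈ x′ + y′
    +-cong (mk≈ p q) (mk≈ r s) = mk≈ (+ᴿ-cong p r) (+ᴿ-cong q s)

    -‿cong : ∀ {x y} → x ≈ y → - x ≈ - y
    -‿cong (mk≈ p q) = mk≈ (-ᴿ-cong p) (-ᴿ-cong q)

    *-cong : ∀ {x x′ y y′} → x ≈ x′ → y ≈ y′ → x * y ≈ x′ * y′
    *-cong (mk≈ p q) (mk≈ r s) =
      mk≈ (+ᴿ-cong (*ᴿ-cong p r) (-ᴿ-cong (*ᴿ-cong q s)))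
          (+ᴿ-cong (*ᴿ-cong p s) (*ᴿ-cong q r))

    *-assoc : ∀ x y z → (x * y) * z ≈ x * (y * z)
    *-assoc x y z = pointwise
      (λ n → solve 6 (λ a b c d e f →
          ((a :* c) :+ (:- (b :* d))) :* e :+ (:- (((a :* d) :+ (b :* c)) :* f)) :=
          a :* ((c :* e) :+ (:- (d :* f))) :+ (:- (b :* ((c :* f) :+ (d :* e))))) refl
        (seq (re x) n) (seq (im x) n) (seq (re y) n) (seq (im y) n) (seq (re z) n) (seq (im z) n))
      (λ n → solve 6 (λ a b c d e f →
          ((a :* c) :+ (:- (b :* d))) :* f :+ (((a :* d) :+ (b :* c)) :* e) :=
          a :* ((c :* f) :+ (d :* e)) :+ (b :* ((c :* e) :+ (:- (d :* f))))) refl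
        (seq (re x) n) (seq (im x) n) (seq (re y) n) (seq (im y) n) (seq (re z) n) (seq (im z) n))

    *-comm : ∀ x y → x * y ≈ y * x
    *-comm x y = pointwise
      (λ n → solve 4 (λ a b c d → (a :* c) :+ (:- (b :* d)) := (c :* a) :+ (:- (d :* b))) refl
        (seq (re x) n) (seq (im x) n) (seq (re y) n) (seq (im y) n))
      (λ n → solve 4 (λ a b c d → (a :* d) :+ (b :* c) := (c :* b) :+ (d :* a)) refl
        (seq (re x) n) (seq (im x) n) (seq (re y) n) (seq (im y) n))

    *-identityˡ : ∀ x → 1ℂ * x ≈ x
    *-identityˡ x = pointwise
      (λ n → solve 2 (λ a b → (con 1ℚ :* a) :+ (:- (con 0ℚ :* b)) := a) refl (seq (re x) n) (seq (im x) n))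
      (λ n → solve 2 (λ a b → (con 1ℚ :* b) :+ (con 0ℚ :* a) := b) refl (seq (re x) n) (seq (im x) n))

    distribʳ : ∀ x y z → (y + z) * x ≈ y * x + z * x
    distribʳ x y z = pointwise
      (λ n → solve 6 (λ a b c d e f →
          ((c :+ e) :* a) :+ (:- ((d :+ f) :* b)) :=
          ((c :* a) :+ (:- (d :* b))) :+ ((e :* a) :+ (:- (f :* b)))) refl
        (seq (re x) n) (seq (im x) n) (seq (re y) n) (seq (im y) n) (seq (re z) n) (seq (im z) n))
      (λ n → solve 6 (λ a b c d e f →
          ((c :+ e) :* b) :+ ((d :+ f) :* a) :=
          ((c :* b) :+ (d :* a)) :+ ((e :* b) :+ (f :* a))) refl
        (seq (re x) n) (seq (im x) n) (seq (re y) n) (seq (im y) n) (seq (re z) n) (seq (im z) n))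

    open IsEquivalence ≈-isEquivalence using () renaming (trans to ≈-trans)

    isCommutativeRing : IsCommutativeRing _≈_ _+_ _*_ -_ 0ℂ 1ℂ
    isCommutativeRing = record
      { isRing = record
        { +-isAbelianGroup = record
          { isGroup = record
            { isMonoid = record
              { isSemigroup = record
                { isMagma = record { isEquivalence = ≈-isEquivalence ; ∙-cong = +-cong }
                ; assoc   = λ x y z → pointwise
                    (λ n → ℚ.+-assoc (seq (re x) n) (seq (re y) n) (seq (re z) n))
                    (λ n → ℚ.+-assoc (seq (im x) n) (seq (im y) n) (seq (im z) n))
                }
              ; identity =
                  (λ x → pointwise (λ n → ℚ.+-identityˡ (seq (re x) n)) (λ n → ℚ.+-identityˡ (seq (im x) n)))
                , (λ x → pointwise (λ n → ℚ.+-identityʳ (seq (re x) n)) (λ n → ℚ.+-identityʳ (seq (im x) n)))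
              }
            ; inverse =
                (λ x → pointwise (λ n → ℚ.+-inverseˡ (seq (re x) n)) (λ n → ℚ.+-inverseˡ (seq (im x) n)))
              , (λ x → pointwise (λ n → ℚ.+-inverseʳ (seq (re x) n)) (λ n → ℚ.+-inverseʳ (seq (im x) n)))
            ; ⁻¹-cong = -‿cong
            }
          ; comm = λ x y → pointwise (λ n → ℚ.+-comm (seq (re x) n) (seq (re y) n))
                                     (λ n → ℚ.+-comm (seq (im x) n) (seq (im y) n))
          }
        ; *-cong     = *-cong
        ; *-assoc    = *-assoc
        ; *-identity = *-identityˡ , λ x → ≈-trans (*-comm x 1ℂ) (*-identityˡ x)
        ; distrib    = (λ x y z → ≈-trans (*-comm x (y + z))
                          (≈-trans (distribʳ x y z) (+-cong (*-comm y x) (*-comm z x))))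
                     , distribʳ
        }
      ; *-comm = *-comm
      }

    #ᴿ-sym : ∀ {x y} → x #ᴿ y → y #ᴿ x
    #ᴿ-sym {x} {y} (mk# x#y) = mk# (away-neg {difference x y} {difference y x}
      (λ n → solve 2 (λ a b → b :- a := :- (a :- b)) refl (seq x n) (seq y n)) x#y)

    -ᴿ-cauchy : ∀ x y → IsCauchy (difference x y)
    -ᴿ-cauchy x y = cauchy (x +ᴿ (-ᴿ y))

    #ᴿ-irrefl : ∀ {x y} → x ≃ y → ¬ x #ᴿ y
    #ᴿ-irrefl {x} {y} (mk≃ v) (mk# a) = vanish⇒¬away {difference x y} v a

    #ᴿ-cotrans : ∀ {x y} → x #ᴿ y → ∀ z → x #ᴿ z ⊎ z #ᴿ y
    #ᴿ-cotrans {x} {y} (mk# x#y) z = map mk# mk#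
      (away-+ {difference x z} {difference z y} {difference x y} (-ᴿ-cauchy x z) (-ᴿ-cauchy z y)
        (λ n → solve 3 (λ a b c → a :- c := (a :- b) :+ (b :- c)) refl (seq x n) (seq z n) (seq y n))
        x#y)

    #ᴿ-tight : ∀ {x y} → ¬ x #ᴿ y → x ≃ y
    #ᴿ-tight {x} {y} ¬x#y = mk≃ (¬away⇒vanish {difference x y} (-ᴿ-cauchy x y) (¬x#y ∘ mk#))

    #-irrefl : ∀ {z w} → z ≈ w → ¬ z # w
    #-irrefl (mk≈ p _) (re# a) = #ᴿ-irrefl p a
    #-irrefl (mk≈ _ q) (im# a) = #ᴿ-irrefl q a

    #-sym : ∀ {z w} → z # w → w # z
    #-sym (re# a) = re# (#ᴿ-sym a)
    #-sym (im# a) = im# (#ᴿ-sym a)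

    #-cotrans : ∀ {z w} → z # w → ∀ u → z # u ⊎ u # w
    #-cotrans (re# a) u = map re# re# (#ᴿ-cotrans a (re u))
    #-cotrans (im# a) u = map im# im# (#ᴿ-cotrans a (im u))

    isApartnessRelation : IsApartnessRelation _≈_ _#_
    isApartnessRelation = record
      { irrefl  = #-irrefl
      ; sym     = #-sym
      ; cotrans = #-cotrans
      }

    Nonzero : ℂ → Set
    Nonzero z = BoundedAway (seq (re z)) ⊎ BoundedAway (seq (im z))

    #⇒nonzero : ∀ {x y} → x # y → Nonzero (x - y)
    #⇒nonzero (re# a) = inj₁ (boundedAway a)
    #⇒nonzero (im# a) = inj₂ (boundedAway a)

    nonzero⇒# : ∀ {x y} → Nonzero (x - y) → x # y
    nonzero⇒# (inj₁ a) = re# (mk# a)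
    nonzero⇒# (inj₂ a) = im# (mk# a)

    invert : ∀ z → Nonzero z → Σ[ w ∈ ℂ ] z * w ≈ 1ℂ
    invert z z≠0 = w , mk≈
      (eventually-≡⇒≃ {re (z * w)} {re 1ℂ} (mapEv (λ n ne → trans
          (solve 3 (λ a b i → (a :* (a :* i)) :+ (:- (b :* ((:- b) :* i))) := (a :* a :+ b :* b) :* i) refl
            (seq a n) (seq b n) (inv (norm n)))
          (inv-inverseʳ (norm n) ne)) norm≢0))
      (≡⇒≃ {im (z * w)} {im 1ℂ} λ n → solve 3 (λ a b i → (a :* ((:- b) :* i)) :+ (b :* (a :* i)) := con 0ℚ) refl
          (seq a n) (seq b n) (inv (norm n)))
      where
      a b : ℝ
      a = re z
      b = im z
      norm : ℕ → ℚ
      norm n = seq a n ℚ.* seq a n ℚ.+ seq b n ℚ.* seq b n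
      away : BoundedAway norm
      away = away-sq {seq a} {seq b} z≠0
      norm≢0 : Eventually λ n → norm n ≢ 0ℚ
      norm≢0 = mapEv (λ n → away⇒≢0 (norm n) (proj₁ (proj₂ away))) (proj₂ (proj₂ away))
      norm⁻¹ : ℝ
      seq    norm⁻¹ n = inv (norm n)
      cauchy norm⁻¹   = inv-cauchy {norm} (cauchy ((a *ᴿ a) +ᴿ (b *ᴿ b))) away
      w : ℂ
      w = (a *ᴿ norm⁻¹) +i ((-ᴿ b) *ᴿ norm⁻¹)

    nonzero : ∀ z w → z * w ≈ 1ℂ → Nonzero z
    nonzero z w (mk≈ p _) = map
      (λ ac → away-* {seq a} {seq c} (cauchy a) (cauchy c) ac)
      (λ bd → away-* {seq b} {seq d} (cauchy b) (cauchy d)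
                (away-neg {seq (-ᴿ (b *ᴿ d))} {seq (b *ᴿ d)} (λ n → sym (neg-involutive (seq b n ℚ.* seq d n))) bd))
      (away-+ {seq (a *ᴿ c)} {seq (-ᴿ (b *ᴿ d))} {seq ac-bd}
        (cauchy (a *ᴿ c)) (cauchy (-ᴿ (b *ᴿ d))) (λ _ → refl)
        (away-1 {seq ac-bd} (vanishing p)))
      where
      a b c d ac-bd : ℝ
      a = re z
      b = im z
      c = re w
      d = im w
      ac-bd = (a *ᴿ c) +ᴿ (-ᴿ (b *ᴿ d))
      neg-involutive : ∀ p → ℚ.- (ℚ.- p) ≡ p
      neg-involutive = solve 1 (λ p → :- (:- p) := p) refl

    #⇒invertible : ∀ {x y} → x # y → Σ[ w ∈ ℂ ] (w * (x - y) ≈ 1ℂ × (x - y) * w ≈ 1ℂ)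
    #⇒invertible {x} {y} x#y =
      let w , [x-y]w≈1 = invert (x - y) (#⇒nonzero x#y)
      in w , ≈-trans (*-comm w (x - y)) [x-y]w≈1 , [x-y]w≈1

    invertible⇒# : ∀ {x y} → Σ[ w ∈ ℂ ] (w * (x - y) ≈ 1ℂ × (x - y) * w ≈ 1ℂ) → x # y
    invertible⇒# {x} {y} (w , _ , [x-y]w≈1) = nonzero⇒# (nonzero (x - y) w [x-y]w≈1)

    isHeytingField : IsHeytingField _≈_ _#_ _+_ _*_ -_ 0ℂ 1ℂ
    isHeytingField = record
      { isHeytingCommutativeRing = record
        { isCommutativeRing   = isCommutativeRing
        ; isApartnessRelation = isApartnessRelation
        ; #⇒invertible        = #⇒invertible
        ; invertible⇒#        = invertible⇒#
        }
      ; tight = λ x y → (λ ¬x#y → mk≈ (#ᴿ-tight (¬x#y ∘ re#)) (#ᴿ-tight (¬x#y ∘ im#))) , #-irrefl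
      }

ℂ-heytingField : HeytingField 0ℓ 0ℓ 0ℓ
ℂ-heytingField = record { isHeytingField = Complex.isHeytingField }

private
  module ℂᶠ = HeytingField ℂ-heytingField

ℂ-commutativeRing : CommutativeRing 0ℓ 0ℓ
ℂ-commutativeRing = record { isCommutativeRing = ℂᶠ.isCommutativeRing }

private
  module ℂʳ = CommutativeRing ℂ-commutativeRing

open import Algebra.Properties.Monoid.Sum ℂʳ.+-monoid public
  using (sum⁺-syntax)
open import Algebra.Properties.Semiring.Exp ℂʳ.semiring public
  using (_^_)
open import Algebra.Properties.Group ℂʳ.+-group using (ε⁻¹≈ε)

-- #⇒invertible inverts z - 0ℂ.
reciprocal : (z : ℂ) → z # 0ℂ → ℂ
reciprocal z z#0 = proj₁ (ℂᶠ.#⇒invertible {z} {0ℂ} z#0)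

reciprocal-inverse : ∀ z (z#0 : z # 0ℂ) → z * reciprocal z z#0 ≈ 1ℂ
reciprocal-inverse z z#0 =
  ℂʳ.trans (ℂʳ.*-congʳ {x = reciprocal z z#0} (ℂʳ.sym z-0≈z))
           (proj₂ (proj₂ (ℂᶠ.#⇒invertible {z} {0ℂ} z#0)))
  where
  z-0≈z : z - 0ℂ ≈ z
  z-0≈z = ℂʳ.trans (ℂʳ.+-congˡ {x = z} ε⁻¹≈ε) (ℂʳ.+-identityʳ z)

------------------------------------------------------------------------
-- Fibonacci-type sequences

IsGeneralizedFibonacci : (ℤ → ℂ) → Set
IsGeneralizedFibonacci G = ∀ m → G (m ℤ.+ + 2) ≈ G (m ℤ.+ + 1) + G m

-- The last clause is the recurrence solved for its lowest term.
lucas : ℤ → ℤ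
lucas (+ 0)              = + 2
lucas (+ 1)              = + 1
lucas (+ suc (suc n))    = lucas (+ suc n) ℤ.+ lucas (+ n)
lucas -[1+ 0 ]           = ℤ.- + 1
lucas -[1+ 1 ]           = + 3
lucas -[1+ suc (suc n) ] = lucas -[1+ n ] ℤ.- lucas -[1+ suc n ]

lucas-recurrence : ∀ m → lucas (m ℤ.+ + 2) ≡ lucas (m ℤ.+ + 1) ℤ.+ lucas m
lucas-recurrence (+ n) rewrite ℕ.+-comm n 2 | ℕ.+-comm n 1 = refl
lucas-recurrence -[1+ 0 ] = refl
lucas-recurrence -[1+ 1 ] = refl
lucas-recurrence -[1+ suc (suc n) ] = lemma (lucas -[1+ n ]) (lucas -[1+ suc n ])
  where
  open ℤSolver.+-*-Solver using (solve; _:+_; _:-_; _:=_)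
  lemma : ∀ i j → i ≡ j ℤ.+ (i ℤ.- j)
  lemma = solve 2 (λ i j → i := j :+ (i :- j)) refl

-- (-1)^e for e ∈ ℤ, using (-1)^(-e) = (-1)^e.
[-1]^_ : ℤ → ℂ
[-1]^ e = (- 1ℂ) ^ ℤ.∣ e ∣

module _ (G : ℤ → ℂ) (a b : ℤ) (x : ℂ) where

  P : ℕ → ℕ → ℂ
  P v w = ∑[ k ≤ v ]
    (fromℤ (+ (v C toℕ k)) * ([-1]^ ((b ℤ.+ + 1) ℤ.* + toℕ k)) * x ^ toℕ k
      * G (a ℤ.+ b ℤ.* + w ℤ.- b ℤ.* + toℕ k))

Δ : ℤ → ℂ → ℂ
Δ b x = 1ℂ - fromℤ (lucas b) * x + ([-1]^ b) * x ^ 2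

{-# OPTIONS --safe #-}

-- For fixed m both b ↦ G (m + b) + (-1)ᵇ G (m - b) and b ↦ L_b G m satisfy the
-- Fibonacci recurrence and agree at b = 0, 1, hence they are equal. So the
-- sequence g k = G (a + b k) satisfies g (k + 2) = L_b g (k + 1) - (-1)ᵇ g k, and
-- for such a sequence the sum of xᵏ g k, multiplied by Δ, telescopes.

module Submission where

open import Algebra.Bundles using (CommutativeRing; CommutativeSemiring)
open import Data.Nat.Base using (ℕ; zero; suc)
open import Data.Fin.Base using (toℕ)

-- Telescoping weighted sums of a second-order linear recurrence

module LinearRecurrence {c ℓ} (R : CommutativeSemiring c ℓ) where
  open CommutativeSemiring R
  open import Algebra.Properties.Semiring.Exp semiring using (_^_)
  open import Algebra.Properties.Semiring.Sum semiring
    using (sum-syntax; sum-cong-≋; *-distribˡ-sum)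
  open import Algebra.Solver.Ring.NaturalCoefficients.Default R
    using (solve; _:+_; _:*_; _:^_; _:=_; con)
  open import Relation.Binary.Reasoning.Setoid setoid

  -- Δ = 1 - (l x + t x²) is split over the two sides, so that no subtraction
  -- occurs.
  sum-telescopes : ∀ l t x (g : ℕ → Carrier) →
    (∀ k → g (suc (suc k)) ≈ l * g (suc k) + t * g k) → ∀ n →
    ∑[ k < n ] (x ^ toℕ k * g (suc (toℕ k))) + x ^ n * (g (suc n) + t * x * g n)
      ≈ (l * x + t * x ^ 2) * (∑[ k < n ] (x ^ toℕ k * g (suc (toℕ k)))) + (g 1 + t * x * g 0)
  sum-telescopes l t x g rec zero =
    solve 4 (λ l t x e → con 0 :+ con 1 :* e := (l :* x :+ t :* x :^ 2) :* con 0 :+ e)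
      refl l t x (g 1 + t * x * g 0)
  sum-telescopes l t x g rec (suc n) = begin
    (1# * g 1 + ∑tail) + x ^ suc n * e
      ≈⟨ +-congʳ (+-congˡ ∑tail≈x*S) ⟩
    (1# * g 1 + x * S) + x ^ suc n * e
      ≈⟨ solve 5 (λ x g₁ S y e → (con 1 :* g₁ :+ x :* S) :+ (x :* y) :* e
                             := g₁ :+ x :* (S :+ y :* e))
           refl x (g 1) S (x ^ n) e ⟩
    g 1 + x * (S + x ^ n * e)
      -- With `g 1` split off, the rest is `x` times the left-hand side for the shifted sequence.
      ≈⟨ +-congˡ (*-congˡ (sum-telescopes l t x (λ k → g (suc k)) (λ k → rec (suc k)) n)) ⟩
    g 1 + x * ((l * x + t * x ^ 2) * S + (g 2 + t * x * g 1))
      -- Expanding `g 2` makes the boundary term yield `(l * x + t * x ^ 2) * g 1`, the missing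
      -- first summand on the right, and leaves `t * x * g 0`.
      ≈⟨ +-congˡ (*-congˡ (+-congˡ (+-congʳ (rec 0)))) ⟩
    g 1 + x * ((l * x + t * x ^ 2) * S + (l * g 1 + t * g 0 + t * x * g 1))
      ≈⟨ solve 6 (λ l t x g₀ g₁ S →
             g₁ :+ x :* ((l :* x :+ t :* x :^ 2) :* S :+ (l :* g₁ :+ t :* g₀ :+ t :* x :* g₁))
             := (l :* x :+ t :* x :^ 2) :* (con 1 :* g₁ :+ x :* S) :+ (g₁ :+ t :* x :* g₀))
           refl l t x (g 0) (g 1) S ⟩
    (l * x + t * x ^ 2) * (1# * g 1 + x * S) + (g 1 + t * x * g 0)
      ≈⟨ +-congʳ (*-congˡ (+-congˡ ∑tail≈x*S)) ⟨
    (l * x + t * x ^ 2) * (1# * g 1 + ∑tail) + (g 1 + t * x * g 0)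
      ∎
    where
    S ∑tail e : Carrier
    S     = ∑[ k < n ] (x ^ toℕ k * g (suc (suc (toℕ k))))
    ∑tail = ∑[ k < n ] (x ^ suc (toℕ k) * g (suc (suc (toℕ k))))
    e     = g (suc (suc n)) + t * x * g (suc n)
    ∑tail≈x*S : ∑tail ≈ x * S
    ∑tail≈x*S = trans (sum-cong-≋ {n} (λ k → *-assoc x (x ^ toℕ k) (g (suc (suc (toℕ k))))))
                      (sym (*-distribˡ-sum {n} x _))

-- Solving a linear equation for the sum

module SolveLinear {c ℓ} (R : CommutativeRing c ℓ) where
  open CommutativeRing R
  open import Algebra.Properties.Ring ring
    using (+-cancelˡ; -‿distribˡ-*; -‿distribʳ-*; -‿anti-homo-+; -‿involutive)
  open import Relation.Binary.Reasoning.Setoid setoid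

  -- Writing `s` as `k * s + d * s` and cancelling `k * s` leaves `d * s ≈ v - u`, which is then
  -- multiplied by the inverse `r` of `d`.
  solve-linear : ∀ {d r k s u v} → d * r ≈ 1# → d + k ≈ 1# → s + u ≈ k * s + v →
                 s ≈ - r * (u - v)
  solve-linear {d} {r} {k} {s} {u} {v} dr≈1 d+k≈1 eq = begin
    s                  ≈⟨ *-identityˡ s ⟨
    1# * s             ≈⟨ *-congʳ dr≈1 ⟨
    (d * r) * s        ≈⟨ *-congʳ (*-comm d r) ⟩
    (r * d) * s        ≈⟨ *-assoc r d s ⟩
    r * (d * s)        ≈⟨ *-congˡ ds≈v-u ⟩
    r * (v - u)        ≈⟨ *-congˡ -[u-v]≈v-u ⟨
    r * - (u - v)      ≈⟨ -‿distribʳ-* r (u - v) ⟨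
    - (r * (u - v))    ≈⟨ -‿distribˡ-* r (u - v) ⟩
    - r * (u - v)      ∎
    where
    -[u-v]≈v-u : - (u - v) ≈ v - u
    -[u-v]≈v-u = trans (-‿anti-homo-+ u (- v)) (+-congʳ (-‿involutive v))
    ks+[ds+u]≈ks+v : k * s + (d * s + u) ≈ k * s + v
    ks+[ds+u]≈ks+v = begin
      k * s + (d * s + u)  ≈⟨ +-assoc _ _ _ ⟨
      k * s + d * s + u    ≈⟨ +-congʳ (distribʳ s k d) ⟨
      (k + d) * s + u      ≈⟨ +-congʳ (*-congʳ (trans (+-comm k d) d+k≈1)) ⟩
      1# * s + u           ≈⟨ +-congʳ (*-identityˡ s) ⟩
      s + u                ≈⟨ eq ⟩
      k * s + v            ∎
    ds≈v-u : d * s ≈ v - u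
    ds≈v-u = begin
      d * s            ≈⟨ +-identityʳ _ ⟨
      d * s + 0#       ≈⟨ +-congˡ (-‿inverseʳ u) ⟨
      d * s + (u - u)  ≈⟨ +-assoc _ _ _ ⟨
      d * s + u - u    ≈⟨ +-congʳ (+-cancelˡ (k * s) _ _ ks+[ds+u]≈ks+v) ⟩
      v - u            ∎

open import Defs
import Algebra.Properties.Ring as RingProperties
import Algebra.Solver.Ring.NaturalCoefficients.Default as SemiringSolver
open import Data.Integer.Base as ℤ using (ℤ; +_; -[1+_])
import Data.Integer.Properties as ℤ
import Data.Integer.Solver as ℤSolver
import Data.Nat.Properties as ℕ
open import Data.Product.Base using (_×_; _,_; proj₁)
open import Data.Rational.Base as ℚ using (∣_∣)
import Data.Rational.Properties as ℚ
import Data.Rational.Unnormalised.Base as ℚᵘ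
import Data.Rational.Unnormalised.Properties as ℚᵘ
open import Relation.Binary.PropositionalEquality as ≡ using (_≡_)
import Relation.Binary.Reasoning.Setoid as SetoidReasoning

private
  module ℂʳ = CommutativeRing ℂ-commutativeRing
open ℂʳ using (refl; sym; trans; +-cong; +-congˡ; +-congʳ; *-congˡ; *-congʳ; -‿cong)
open RingProperties ℂʳ.ring using (-1*x≈-x; -‿involutive; -‿distribˡ-*; +-cancelʳ)
open LinearRecurrence ℂʳ.commutativeSemiring using (sum-telescopes)
open SolveLinear ℂ-commutativeRing using (solve-linear)
open SemiringSolver ℂʳ.commutativeSemiring using (solve; _:+_; _:*_; _:=_; con)
open ℤSolver.+-*-Solver using ()
  renaming (solve to solveℤ; _:+_ to _⊕_; _:*_ to _⊗_; _:-_ to _⊖_; _:=_ to _⊜_; con to conℤ)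
open SetoidReasoning ℂʳ.setoid

-- Integers and signs as complex numbers

-- Passing to unnormalised rationals avoids reduction to lowest terms; with all denominators 1, an
-- integer identity remains.
/1-homo-+ : ∀ i j → (i ℤ.+ j) ℚ./ 1 ≡ i ℚ./ 1 ℚ.+ j ℚ./ 1
/1-homo-+ i j = ℚ.toℚᵘ-injective (ℚᵘ.≃-trans (ℚ.toℚᵘ-fromℚᵘ (ℚᵘ.mkℚᵘ (i ℤ.+ j) 0))
  (ℚᵘ.≃-trans [i+j]/1≃i/1+j/1
  (ℚᵘ.≃-sym (ℚᵘ.≃-trans (ℚ.toℚᵘ-homo-+ (i ℚ./ 1) (j ℚ./ 1))
    (ℚᵘ.+-cong (ℚ.toℚᵘ-fromℚᵘ (ℚᵘ.mkℚᵘ i 0)) (ℚ.toℚᵘ-fromℚᵘ (ℚᵘ.mkℚᵘ j 0)))))))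
  where
  [i+j]/1≃i/1+j/1 : ℚᵘ.mkℚᵘ (i ℤ.+ j) 0 ℚᵘ.≃ ℚᵘ.mkℚᵘ i 0 ℚᵘ.+ ℚᵘ.mkℚᵘ j 0
  [i+j]/1≃i/1+j/1 = ℚᵘ.*≡* (solveℤ 2 (λ i j →
    (i ⊕ j) ⊗ conℤ (+ 1) ⊜ (i ⊗ conℤ (+ 1) ⊕ j ⊗ conℤ (+ 1)) ⊗ conℤ (+ 1)) ≡.refl i j)

≡⇒≃ : ∀ {x y} → (∀ n → seq x n ≡ seq y n) → x ≃ y
≡⇒≃ {x} {y} eq = mk≃ λ ε 0<ε → 0 , λ n _ →
  ≡.subst (λ d → ∣ d ∣ ℚ.< ε)
    (≡.sym (≡.trans (≡.cong (ℚ._- seq y n) (eq n)) (ℚ.+-inverseʳ (seq y n)))) 0<ε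

fromℤ-homo-+ : ∀ i j → fromℤ (i ℤ.+ j) ≈ fromℤ i + fromℤ j
fromℤ-homo-+ i j = mk≈ (≡⇒≃ λ _ → /1-homo-+ i j) (≡⇒≃ λ _ → ≡.refl)

fromℤ-1 : fromℤ (+ 1) ≈ 1ℂ
fromℤ-1 = mk≈ (≡⇒≃ λ _ → ≡.refl) (≡⇒≃ λ _ → ≡.refl)

-- The exponent enters through its absolute value: for `b` nonnegative a factor -1 is gained, for
-- `b` negative one is lost, and either way the sign flips.
[-1]^-suc : ∀ b → [-1]^ (b ℤ.+ + 1) ≈ - ([-1]^ b)
[-1]^-suc (+ n) rewrite ℕ.+-comm n 1 = -1*x≈-x ((- 1ℂ) ^ n)
[-1]^-suc -[1+ zero ] = sym (trans (-‿cong (-1*x≈-x 1ℂ)) (-‿involutive 1ℂ))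
[-1]^-suc -[1+ suc n ] =
  sym (trans (-‿cong (-1*x≈-x ((- 1ℂ) ^ suc n))) (-‿involutive ((- 1ℂ) ^ suc n)))

[-1]^-+2 : ∀ b → [-1]^ (b ℤ.+ + 2) ≈ [-1]^ b
[-1]^-+2 b = begin
  [-1]^ (b ℤ.+ + 2)          ≡⟨ ≡.cong [-1]^_ (ℤ.+-assoc b (+ 1) (+ 1)) ⟨
  [-1]^ (b ℤ.+ + 1 ℤ.+ + 1)  ≈⟨ [-1]^-suc (b ℤ.+ + 1) ⟩
  - ([-1]^ (b ℤ.+ + 1))      ≈⟨ -‿cong ([-1]^-suc b) ⟩
  - - ([-1]^ b)              ≈⟨ -‿involutive ([-1]^ b) ⟩
  [-1]^ b                    ∎

-- Uniqueness of Fibonacci-type sequences with given seed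

-- Induction in both directions on agreement at two neighbouring indices; going down, the recurrence
-- is solved for its lowest term by cancellation.
fibonacci-unique : ∀ {G H} → IsGeneralizedFibonacci G → IsGeneralizedFibonacci H →
  G (+ 0) ≈ H (+ 0) → G (+ 1) ≈ H (+ 1) → ∀ m → G m ≈ H m
fibonacci-unique {G} {H} fibG fibH eq₀ eq₁ = agree
  where
  Agree : ℤ → Set
  Agree m = G m ≈ H m × G (m ℤ.+ + 1) ≈ H (m ℤ.+ + 1)

  up : ∀ m → Agree m → Agree (m ℤ.+ + 1)
  up m (p , q) = q , ≡.subst (λ k → G k ≈ H k) (≡.sym (ℤ.+-assoc m (+ 1) (+ 1)))
    (trans (fibG m) (trans (+-cong q p) (sym (fibH m))))

  down : ∀ m → Agree (m ℤ.+ + 1) → Agree m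
  down m (p , q) = +-cancelʳ (G (m ℤ.+ + 1)) (G m) (H m) (begin
    G m + G (m ℤ.+ + 1)  ≈⟨ ℂʳ.+-comm (G m) (G (m ℤ.+ + 1)) ⟩
    G (m ℤ.+ + 1) + G m  ≈⟨ fibG m ⟨
    G (m ℤ.+ + 2)        ≈⟨ ≡.subst (λ k → G k ≈ H k) (ℤ.+-assoc m (+ 1) (+ 1)) q ⟩
    H (m ℤ.+ + 2)        ≈⟨ fibH m ⟩
    H (m ℤ.+ + 1) + H m  ≈⟨ +-congʳ p ⟨
    G (m ℤ.+ + 1) + H m  ≈⟨ ℂʳ.+-comm (G (m ℤ.+ + 1)) (H m) ⟩
    H m + G (m ℤ.+ + 1)  ∎) , p

  nonneg : ∀ n → Agree (+ n)
  nonneg zero = eq₀ , eq₁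
  nonneg (suc n) = ≡.subst Agree (≡.cong +_ (ℕ.+-comm n 1)) (up (+ n) (nonneg n))

  negative : ∀ n → Agree -[1+ n ]
  negative zero = down -[1+ 0 ] (nonneg 0)
  negative (suc n) = down -[1+ suc n ] (negative n)

  agree : ∀ m → G m ≈ H m
  agree (+ n)    = proj₁ (nonneg n)
  agree -[1+ n ] = proj₁ (negative n)

-- The Lucas multiplication identity

module _ (G : ℤ → ℂ) (fib : IsGeneralizedFibonacci G) where

  -- The reflected sequence satisfies the recurrence backwards; the alternating sign turns it into
  -- the forward one.
  G+[-1]G-fibonacci : ∀ m →
    IsGeneralizedFibonacci (λ b → G (m ℤ.+ b) + ([-1]^ b) * G (m ℤ.- b))
  G+[-1]G-fibonacci m b = begin
    G (m ℤ.+ (b ℤ.+ + 2)) + ([-1]^ (b ℤ.+ + 2)) * w₂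
      ≈⟨ +-cong upper (*-congʳ ([-1]^-+2 b)) ⟩
    (u₁ + u₀) + s * w₂
      ≈⟨ ℂʳ.+-identityʳ _ ⟨
    (u₁ + u₀) + s * w₂ + 0ℂ
      -- This zero supplies both the `s₁ * w₁` of the value at `b + 1` and the `s * w₁` from
      -- expanding `G (m - b)`.
      ≈⟨ +-congˡ (trans (*-congʳ s₁+s≈0) (ℂʳ.zeroˡ w₁)) ⟨
    (u₁ + u₀) + s * w₂ + (s₁ + s) * w₁
      ≈⟨ solve 6 (λ u₁ u₀ s s₁ w₁ w₂ →
             (u₁ :+ u₀) :+ s :* w₂ :+ (s₁ :+ s) :* w₁
             := (u₁ :+ s₁ :* w₁) :+ (u₀ :+ s :* (w₁ :+ w₂)))
           refl u₁ u₀ s s₁ w₁ w₂ ⟩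
    (u₁ + s₁ * w₁) + (u₀ + s * (w₁ + w₂))
      ≈⟨ +-congˡ (+-congˡ (*-congˡ lower)) ⟨
    (u₁ + s₁ * w₁) + (u₀ + s * G (m ℤ.- b))
      ∎
    where
    u₀ u₁ w₁ w₂ s s₁ : ℂ
    u₀ = G (m ℤ.+ b)
    u₁ = G (m ℤ.+ (b ℤ.+ + 1))
    w₁ = G (m ℤ.- (b ℤ.+ + 1))
    w₂ = G (m ℤ.- (b ℤ.+ + 2))
    s  = [-1]^ b
    s₁ = [-1]^ (b ℤ.+ + 1)
    upper : G (m ℤ.+ (b ℤ.+ + 2)) ≈ u₁ + u₀
    upper = begin
      G (m ℤ.+ (b ℤ.+ + 2))    ≡⟨ ≡.cong G (ℤ.+-assoc m b (+ 2)) ⟨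
      G (m ℤ.+ b ℤ.+ + 2)      ≈⟨ fib (m ℤ.+ b) ⟩
      G (m ℤ.+ b ℤ.+ + 1) + u₀ ≡⟨ ≡.cong (λ k → G k + u₀) (ℤ.+-assoc m b (+ 1)) ⟩
      u₁ + u₀                  ∎
    lower : G (m ℤ.- b) ≈ w₁ + w₂
    lower = begin
      G (m ℤ.- b)
        ≡⟨ ≡.cong G (solveℤ 2 (λ m b → m ⊖ b ⊜ m ⊖ (b ⊕ conℤ (+ 2)) ⊕ conℤ (+ 2)) ≡.refl m b) ⟩
      G (m ℤ.- (b ℤ.+ + 2) ℤ.+ + 2)
        ≈⟨ fib (m ℤ.- (b ℤ.+ + 2)) ⟩
      G (m ℤ.- (b ℤ.+ + 2) ℤ.+ + 1) + w₂
        ≡⟨ ≡.cong (λ k → G k + w₂)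
             (solveℤ 2 (λ m b → m ⊖ (b ⊕ conℤ (+ 2)) ⊕ conℤ (+ 1) ⊜ m ⊖ (b ⊕ conℤ (+ 1))) ≡.refl m b) ⟩
      w₁ + w₂
        ∎
    s₁+s≈0 : s₁ + s ≈ 0ℂ
    s₁+s≈0 = trans (+-congʳ ([-1]^-suc b)) (ℂʳ.-‿inverseˡ s)

  lucas*-fibonacci : ∀ z → IsGeneralizedFibonacci (λ b → fromℤ (lucas b) * z)
  lucas*-fibonacci z b = begin
    fromℤ (lucas (b ℤ.+ + 2)) * z
      ≡⟨ ≡.cong (λ l → fromℤ l * z) (lucas-recurrence b) ⟩
    fromℤ (lucas (b ℤ.+ + 1) ℤ.+ lucas b) * z
      ≈⟨ *-congʳ (fromℤ-homo-+ (lucas (b ℤ.+ + 1)) (lucas b)) ⟩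
    (fromℤ (lucas (b ℤ.+ + 1)) + fromℤ (lucas b)) * z
      ≈⟨ ℂʳ.distribʳ z _ _ ⟩
    fromℤ (lucas (b ℤ.+ + 1)) * z + fromℤ (lucas b) * z
      ∎

  G+[-1]G≈lucas*G : ∀ m b →
    G (m ℤ.+ b) + ([-1]^ b) * G (m ℤ.- b) ≈ fromℤ (lucas b) * G m
  G+[-1]G≈lucas*G m = fibonacci-unique (G+[-1]G-fibonacci m) (lucas*-fibonacci (G m))
    (begin
      G (m ℤ.+ + 0) + 1ℂ * G (m ℤ.- + 0)
        ≡⟨ ≡.cong (λ k → G k + 1ℂ * G k) (ℤ.+-identityʳ m) ⟩
      G m + 1ℂ * G m
        ≈⟨ solve 1 (λ z → z :+ con 1 :* z := (con 1 :+ con 1) :* z) refl (G m) ⟩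
      (1ℂ + 1ℂ) * G m
        ≈⟨ *-congʳ (trans (fromℤ-homo-+ (+ 1) (+ 1)) (+-cong fromℤ-1 fromℤ-1)) ⟨
      fromℤ (+ 2) * G m
        ∎)
    -- At `b = 1` the sign computes to `- 1ℂ * 1ℂ` and removes the `G (m - 1)` produced by `split`.
    (begin
      G (m ℤ.+ + 1) + (- 1ℂ * 1ℂ) * w
        ≈⟨ +-cong split (*-congʳ (ℂʳ.*-identityʳ (- 1ℂ))) ⟩
      (G m + w) + - 1ℂ * w
        ≈⟨ +-congˡ (-1*x≈-x w) ⟩
      (G m + w) + - w
        ≈⟨ ℂʳ.+-assoc (G m) w (- w) ⟩
      G m + (w + - w)
        ≈⟨ +-congˡ (ℂʳ.-‿inverseʳ w) ⟩
      G m + 0ℂ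
        ≈⟨ ℂʳ.+-identityʳ (G m) ⟩
      G m
        ≈⟨ ℂʳ.*-identityˡ (G m) ⟨
      1ℂ * G m
        ≈⟨ *-congʳ fromℤ-1 ⟨
      fromℤ (+ 1) * G m
        ∎)
    where
    w : ℂ
    w = G (m ℤ.- + 1)
    split : G (m ℤ.+ + 1) ≈ G m + w
    split = begin
      G (m ℤ.+ + 1)
        ≡⟨ ≡.cong G (solveℤ 1 (λ m → m ⊕ conℤ (+ 1) ⊜ m ⊖ conℤ (+ 1) ⊕ conℤ (+ 2)) ≡.refl m) ⟩
      G (m ℤ.- + 1 ℤ.+ + 2)
        ≈⟨ fib (m ℤ.- + 1) ⟩
      G (m ℤ.- + 1 ℤ.+ + 1) + w
        ≡⟨ ≡.cong (λ k → G k + w)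
             (solveℤ 1 (λ m → m ⊖ conℤ (+ 1) ⊕ conℤ (+ 1) ⊜ m) ≡.refl m) ⟩
      G m + w
        ∎

  -- The Lucas identity solved for `G (m + b)`. The minus sign is absorbed into the exponent
  -- `b + 1`, which gives the subtraction-free form of `sum-telescopes` and the sign occurring in
  -- `P`.
  progression-recurrence : ∀ m b →
    G (m ℤ.+ b) ≈ fromℤ (lucas b) * G m + ([-1]^ (b ℤ.+ + 1)) * G (m ℤ.- b)
  progression-recurrence m b = begin
    u                        ≈⟨ ℂʳ.+-identityʳ u ⟨
    u + 0ℂ                   ≈⟨ +-congˡ (ℂʳ.-‿inverseʳ (s * w)) ⟨
    u + (s * w + - (s * w))  ≈⟨ ℂʳ.+-assoc u (s * w) (- (s * w)) ⟨
    u + s * w + - (s * w)    ≈⟨ +-cong (G+[-1]G≈lucas*G m b)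
                                  (trans (-‿distribˡ-* s w) (*-congʳ (sym ([-1]^-suc b)))) ⟩
    fromℤ (lucas b) * G m + ([-1]^ (b ℤ.+ + 1)) * w  ∎
    where
    u w s : ℂ
    u = G (m ℤ.+ b)
    w = G (m ℤ.- b)
    s = [-1]^ b

-- The boundary terms and the denominator

-- This form matches the boundary expression in `sum-telescopes`.
P-1 : ∀ G a b x w →
  P G a b x 1 w ≈ G (a ℤ.+ b ℤ.* + w) + ([-1]^ (b ℤ.+ + 1)) * x * G (a ℤ.+ b ℤ.* + w ℤ.- b)
P-1 G a b x w = begin
  P G a b x 1 w
    -- The two-term sum and its binomial coefficients unfold by computation; only products with 0
    -- and 1 on the right need rewriting.
    ≡⟨ ≡.cong₂ _+_
         (≡.cong₂ (λ e m → fromℤ (+ 1) * ([-1]^ e) * 1ℂ * G m)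
            (ℤ.*-zeroʳ (b ℤ.+ + 1))
            (solveℤ 2 (λ p b → p ⊖ b ⊗ conℤ (+ 0) ⊜ p) ≡.refl (a ℤ.+ b ℤ.* + w) b))
         (≡.cong₂ (λ e c → fromℤ (+ 1) * ([-1]^ e) * (x * 1ℂ) * G (a ℤ.+ b ℤ.* + w ℤ.- c) + 0ℂ)
            (ℤ.*-identityʳ (b ℤ.+ + 1)) (ℤ.*-identityʳ b)) ⟩
  fromℤ (+ 1) * 1ℂ * 1ℂ * u + (fromℤ (+ 1) * t * (x * 1ℂ) * v + 0ℂ)
    ≈⟨ +-cong (*-congʳ (*-congʳ (*-congʳ fromℤ-1)))
              (+-congʳ (*-congʳ (*-congʳ (*-congʳ fromℤ-1)))) ⟩
  1ℂ * 1ℂ * 1ℂ * u + (1ℂ * t * (x * 1ℂ) * v + 0ℂ)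
    ≈⟨ solve 4 (λ t x u v →
           con 1 :* con 1 :* con 1 :* u :+ (con 1 :* t :* (x :* con 1) :* v :+ con 0)
           := u :+ t :* x :* v)
         refl t x u v ⟩
  u + t * x * v
    ∎
  where
  t u v : ℂ
  t = [-1]^ (b ℤ.+ + 1)
  u = G (a ℤ.+ b ℤ.* + w)
  v = G (a ℤ.+ b ℤ.* + w ℤ.- b)

-- Supplies the hypothesis `d + k ≈ 1#` of `solve-linear`: the signs for `b` and `b + 1` are
-- opposite, so the quadratic terms cancel.
Δ+[lx+tx²]≈1 : ∀ b x →
  Δ b x + (fromℤ (lucas b) * x + ([-1]^ (b ℤ.+ + 1)) * x ^ 2) ≈ 1ℂ
Δ+[lx+tx²]≈1 b x = begin
  (1ℂ - p + q) + (p + ([-1]^ (b ℤ.+ + 1)) * x ^ 2)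
    ≈⟨ +-congˡ (+-congˡ (trans (*-congʳ ([-1]^-suc b)) (sym (-‿distribˡ-* ([-1]^ b) (x ^ 2))))) ⟩
  (1ℂ - p + q) + (p + - q)
    -- The semiring solver has no negation, so `- p` and `- q` enter as independent variables.
    ≈⟨ solve 4 (λ p p′ q q′ → (con 1 :+ p′ :+ q) :+ (p :+ q′) := con 1 :+ (p :+ p′) :+ (q :+ q′))
         refl p (- p) q (- q) ⟩
  1ℂ + (p + - p) + (q + - q)
    ≈⟨ +-cong (+-congˡ (ℂʳ.-‿inverseʳ p)) (ℂʳ.-‿inverseʳ q) ⟩
  1ℂ + 0ℂ + 0ℂ
    ≈⟨ trans (ℂʳ.+-identityʳ (1ℂ + 0ℂ)) (ℂʳ.+-identityʳ 1ℂ) ⟩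
  1ℂ
    ∎
  where
  p q : ℂ
  p = fromℤ (lucas b) * x
  q = ([-1]^ b) * x ^ 2

-- The weighted sum along an arithmetic progression

mainTheorem1 : (G : ℤ → ℂ) → IsGeneralizedFibonacci G →
    (a b : ℤ) (n : ℕ) (x : ℂ) (Δ#0 : Δ b x # 0ℂ) →
    ∑[ k ≤ n ] (x ^ toℕ k * G (a ℤ.+ b ℤ.* + toℕ k))
    ≈ - reciprocal (Δ b x) Δ#0 * (x ^ suc n * P G a b x 1 (suc n) - P G a b x 1 0)
mainTheorem1 G fib a b n x Δ#0 =
  solve-linear (reciprocal-inverse (Δ b x) Δ#0) (Δ+[lx+tx²]≈1 b x) (begin
    S + x ^ suc n * P G a b x 1 (suc n)
      ≈⟨ +-congˡ (*-congˡ (P-1 G a b x (suc n))) ⟩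
    S + x ^ suc n * (g (suc (suc n)) + t * x * G (a ℤ.+ b ℤ.* + suc n ℤ.- b))
      ≡⟨ ≡.cong (λ z → S + x ^ suc n * (g (suc (suc n)) + t * x * z)) (g-pred (suc n)) ⟩
    S + x ^ suc n * (g (suc (suc n)) + t * x * g (suc n))
      -- The sum over `k ≤ n` has `suc n` terms, and its `k`-th one carries `g (suc k)`.
      ≈⟨ sum-telescopes l t x g g-recurrence (suc n) ⟩
    (l * x + t * x ^ 2) * S + (g 1 + t * x * g 0)
      -- `g 0` is by definition the term with `- b` in `P-1` at `w = 0`, so `g-pred` is not called
      -- for.
      ≈⟨ +-congˡ (P-1 G a b x 0) ⟨
    (l * x + t * x ^ 2) * S + P G a b x 1 0
      ∎)
  where
  l t S : ℂ
  l = fromℤ (lucas b)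
  t = [-1]^ (b ℤ.+ + 1)
  S = ∑[ k ≤ n ] (x ^ toℕ k * G (a ℤ.+ b ℤ.* + toℕ k))

  -- The progression G (a + b j), j ≥ -1, indexed from 0.
  g : ℕ → ℂ
  g zero    = G (a ℤ.+ b ℤ.* + 0 ℤ.- b)
  g (suc k) = G (a ℤ.+ b ℤ.* + k)

  g-pred : ∀ k → G (a ℤ.+ b ℤ.* + k ℤ.- b) ≡ g k
  g-pred zero    = ≡.refl
  g-pred (suc k) = ≡.cong G (≡.trans
    (≡.cong (λ c → a ℤ.+ c ℤ.- b) (ℤ.*-suc b (+ k)))
    (solveℤ 3 (λ a b c → a ⊕ (b ⊕ c) ⊖ b ⊜ a ⊕ c) ≡.refl a b (b ℤ.* + k)))

  g-recurrence : ∀ k → g (suc (suc k)) ≈ l * g (suc k) + t * g k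
  g-recurrence k = begin
    G (a ℤ.+ b ℤ.* + suc k)
      ≡⟨ ≡.cong G (≡.trans (≡.cong (λ c → a ℤ.+ c) (ℤ.*-suc b (+ k)))
           (solveℤ 3 (λ a b c → a ⊕ (b ⊕ c) ⊜ a ⊕ c ⊕ b) ≡.refl a b (b ℤ.* + k))) ⟩
    G (a ℤ.+ b ℤ.* + k ℤ.+ b)
      ≈⟨ progression-recurrence G fib (a ℤ.+ b ℤ.* + k) b ⟩
    l * g (suc k) + t * G (a ℤ.+ b ℤ.* + k ℤ.- b)
      ≡⟨ ≡.cong (λ z → l * g (suc k) + t * z) (g-pred k) ⟩
    l * g (suc k) + t * g k
      ∎
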